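{- Let $n\ge1$, let $q$ be a nonzero indeterminate (or nonzero complex number) and let $h_q(w,y)=qw-q^{ -1}y$ (so $h_1(w,y)=w-y$). Then $$\mathcal{AS}_{w_1,\dots,w_n}\left[\frac{\prod_{1\le i<j\le n}h_q(w_i,w_j)}{\prod_{1\le i\le j\le n}h_1(w_j,y_i)\prod_{1\le j\le i\le n}h_q(w_j,y_i)}\right]=\frac{\det_{1\le i,j\le n}\left(\frac{1}{h_1(w_i,y_j)h_q(w_i,y_j)}\right)}{\prod_{1\le i<j\le n}h_1(y_j,y_i)}$$ as rational functions in $w_1,\dots,w_n,y_1,\dots,y_n$.
   Context: The antisymmetrizer is $\mathcal{AS}_{w_1,\dots,w_n}p(w_1,\dots,w_n)=\sum_{\sigma\in\mathcal S_n}\operatorname{sgn}\sigma\,p(w_{\sigma(1)},\dots,w_{\sigma(n)})$, where $\mathcal S_n$ is the symmetric group. -}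

module Defs where

open import Level using (_⊔_)
open import Algebra.Bundles using (CommutativeRing)
open import Data.Nat using (ℕ; zero; suc)
open import Data.Fin using (Fin; zero; suc; punchIn; _<?_; _<_)
open import Data.Nat using (_≤_)
open import Data.List using (List; []; _∷_; concatMap; map)
open import Data.Bool using (if_then_else_)
open import Relation.Nullary.Decidable using (⌊_⌋)

-- All permutations of Fin n, as functions Fin n → Fin n.
-- A permutation of Fin (suc n) is determined by σ 0 = k and a permutation
-- π of Fin n, via σ (suc i) = punchIn k (π i).
allPerms : (n : ℕ) → List (Fin n → Fin n)
allPerms zero = (λ ()) ∷ []
allPerms (suc n) =
  concatMap (λ π → map (λ k → ext k π) (allFins (suc n))) (allPerms n)
  where
  ext : Fin (suc n) → (Fin n → Fin n) → Fin (suc n) → Fin (suc n)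
  ext k π zero = k
  ext k π (suc i) = punchIn k (π i)
  allFins : (m : ℕ) → List (Fin m)
  allFins zero = []
  allFins (suc m) = zero ∷ map suc (allFins m)

module Ring {c ℓ} (R : CommutativeRing c ℓ) where
  open CommutativeRing R hiding (zero)

  Σᶠ : (n : ℕ) → (Fin n → Carrier) → Carrier
  Σᶠ zero f = 0#
  Σᶠ (suc n) f = f zero + Σᶠ n (λ i → f (suc i))

  Πᶠ : (n : ℕ) → (Fin n → Carrier) → Carrier
  Πᶠ zero f = 1#
  Πᶠ (suc n) f = f zero * Πᶠ n (λ i → f (suc i))

  Π< : (n : ℕ) → (Fin n → Fin n → Carrier) → Carrier
  Π< n f = Πᶠ n (λ i → Πᶠ n (λ j → if ⌊ i <? j ⌋ then f i j else 1#))

  Π≤ : (n : ℕ) → (Fin n → Fin n → Carrier) → Carrier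
  Π≤ n f = Πᶠ n (λ i → Πᶠ n (λ j → if ⌊ j <? i ⌋ then 1# else f i j))

  Σˡ : {A : Set} → List A → (A → Carrier) → Carrier
  Σˡ [] f = 0#
  Σˡ (x ∷ xs) f = f x + Σˡ xs f

  sgn : {n : ℕ} → (Fin n → Fin n) → Carrier
  sgn {n} σ = Π< n (λ i j → if ⌊ σ j <? σ i ⌋ then - 1# else 1#)

  AS : (n : ℕ) → ((Fin n → Carrier) → Carrier) → (Fin n → Carrier) → Carrier
  AS n p w = Σˡ (allPerms n) (λ σ → sgn σ * p (λ i → w (σ i)))

  det : (n : ℕ) → (Fin n → Fin n → Carrier) → Carrier
  det n M = Σˡ (allPerms n) (λ σ → sgn σ * Πᶠ n (λ i → M i (σ i)))

  h : Carrier → Carrier → Carrier → Carrier → Carrier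
  h q q⁻¹ w y = q * w - q⁻¹ * y

  -- Antisymmetrizer written on index permutations: Σ_σ sgn σ · f σ,
  -- where f σ is the summand with w_i replaced by w_{σ(i)}.
  ASᵢ : (n : ℕ) → ((Fin n → Fin n) → Carrier) → Carrier
  ASᵢ n f = Σˡ (allPerms n) (λ σ → sgn σ * f σ)

  Theorem5p3 : Set (c ⊔ ℓ)
  Theorem5p3 =
    (n : ℕ) → 1 ≤ n →
    (q q⁻¹ : Carrier) → q * q⁻¹ ≈ 1# →
    (w y : Fin n → Carrier) →
    (inv₁ : Fin n → Fin n → Carrier) → (∀ a b → h 1# 1# (w a) (y b) * inv₁ a b ≈ 1#) →
    (invq : Fin n → Fin n → Carrier) → (∀ a b → h q q⁻¹ (w a) (y b) * invq a b ≈ 1#) →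
    (invY : Fin n → Fin n → Carrier) → (∀ i j → i < j → h 1# 1# (y j) (y i) * invY i j ≈ 1#) →
    ASᵢ n (λ σ →
        Π< n (λ i j → h q q⁻¹ (w (σ i)) (w (σ j)))
        * Π≤ n (λ i j → inv₁ (σ j) i)
        * Π≤ n (λ j i → invq (σ j) i))
      ≈ det n (λ i j → inv₁ i j * invq i j) * Π< n (λ i j → invY i j)

{-# OPTIONS --safe #-}
-- Expand both sides by induction on n. Singling out k = σ(1) in the antisymmetrizer leaves,
-- up to the factor ∏_j 1/(w_j - y_1), an alternating sum over k of the (n-1)-variable instance
-- times c_k = ∏_{j≠k} h_q(w_k, w_j) / ∏_i h_q(w_k, y_i). By Lagrange interpolation at the nodes
-- y_i, c_k = Σ_i β_i / (h_1(w_k, y_i) h_q(w_k, y_i)) with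
-- β_i = ∏_j (w_j - y_i) / ∏_{m≠i} (y_m - y_i) independent of k. Hence the alternating sum is the
-- determinant with its first column replaced by Σ_i β_i (column i), that is, β_1 times the
-- determinant, and ∏_j (w_j - y_1) cancels.
module Submission where

open import Defs
open import Algebra.Bundles using (CommutativeRing)
open import Data.Bool using (true; false; if_then_else_)
open import Data.Empty using (⊥-elim)
open import Data.Fin using (Fin; zero; suc; punchIn; _<_; _<?_)
open import Data.Fin.Properties using (<-cmp; suc-injective; punchIn-injective)
open import Data.List using (List; []; _∷_; _++_; concatMap; map)
open import Data.List.Relation.Unary.All as All using (All; []; _∷_)
import Data.List.Relation.Unary.All.Properties as All
open import Data.Nat using (ℕ; zero; suc)
open import Function using (_∘_)
open import Level using (_⊔_)
open import Relation.Binary.Definitions using (tri<; tri≈; tri>)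
open import Relation.Binary.PropositionalEquality as ≡ using (_≡_; _≢_; _≗_)
open import Relation.Nullary.Decidable using (yes; no; ⌊_⌋; isYes≗does)

-- The local functions of allPerms cannot be named from here; unification against
-- the unfolded definition recovers them.
mutual
  extend : ∀ n → Fin (suc n) → (Fin n → Fin n) → Fin (suc n) → Fin (suc n)
  extend = _

  fins : (m : ℕ) → List (Fin m)
  fins = _

  allPerms-suc : ∀ n →
    allPerms (suc n) ≡
    concatMap (λ π → map (λ k → extend n k π) (zero ∷ map suc (fins n))) (allPerms n)
  allPerms-suc n = ≡.refl

-- Order comparisons and deletion of indices.

suc-<? : ∀ {n} (i j : Fin n) → ⌊ suc i <? suc j ⌋ ≡ ⌊ i <? j ⌋
-- The `does` fields of the two decisions agree definitionally, so the comparison passes through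
-- `does`.
suc-<? i j = ≡.trans (isYes≗does (suc i <? suc j)) (≡.sym (isYes≗does (i <? j)))

punchIn-<? : ∀ {n} (k : Fin (suc n)) (a b : Fin n) →
  ⌊ punchIn k a <? punchIn k b ⌋ ≡ ⌊ a <? b ⌋
punchIn-<? zero    a       b       = suc-<? a b
punchIn-<? (suc k) zero    zero    = ≡.refl
punchIn-<? (suc k) zero    (suc b) = ≡.refl
punchIn-<? (suc k) (suc a) zero    = ≡.refl
punchIn-<? (suc k) (suc a) (suc b) =
  ≡.trans (suc-<? (punchIn k a) (punchIn k b)) (≡.trans (punchIn-<? k a b) (≡.sym (suc-<? a b)))

lift : ∀ {m n} → (Fin m → Fin n) → Fin (suc m) → Fin (suc n)
lift ρ zero    = zero
lift ρ (suc i) = suc (ρ i)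

lift-cong : ∀ {m n} {ρ τ : Fin m → Fin n} → ρ ≗ τ → lift ρ ≗ lift τ
lift-cong e zero    = ≡.refl
lift-cong e (suc i) = ≡.cong suc (e i)

-- If neither deleted row is row `zero`, that row survives as the first one, which `lift` records.
-- The equality is pointwise, so functions of the surviving rows are later required to respect `≗`.
punchIn-lift : ∀ {n} (k : Fin (suc (suc n))) (l : Fin (suc n)) →
  punchIn (suc k) ∘ punchIn (suc l) ≗ lift (punchIn k ∘ punchIn l)
punchIn-lift k l zero    = ≡.refl
punchIn-lift k l (suc i) = ≡.refl

module _ {c ℓ} (R : CommutativeRing c ℓ) where
  open CommutativeRing R hiding (zero)
  open Ring R
  open import Algebra.Properties.Ring ring
  open import Relation.Binary.Reasoning.Setoid setoid
  open import Algebra.Solver.Ring.NaturalCoefficients.Default commutativeSemiring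
    using (solve; _:+_; _:*_; _:=_)

  -- Finite sums and products

  Σ-cong : ∀ n {f g : Fin n → Carrier} → (∀ i → f i ≈ g i) → Σᶠ n f ≈ Σᶠ n g
  Σ-cong zero    e = refl
  Σ-cong (suc n) e = +-cong (e zero) (Σ-cong n (e ∘ suc))

  Σ-zero : ∀ n {f : Fin n → Carrier} → (∀ i → f i ≈ 0#) → Σᶠ n f ≈ 0#
  Σ-zero zero    e = refl
  Σ-zero (suc n) e = trans (+-cong (e zero) (Σ-zero n (e ∘ suc))) (+-identityˡ 0#)

  Σ-+ : ∀ n (f g : Fin n → Carrier) → Σᶠ n (λ i → f i + g i) ≈ Σᶠ n f + Σᶠ n g
  Σ-+ zero    f g = sym (+-identityˡ 0#)
  Σ-+ (suc n) f g = trans (+-congˡ (Σ-+ n (f ∘ suc) (g ∘ suc)))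
    (solve 4 (λ a b c d → (a :+ b) :+ (c :+ d) := (a :+ c) :+ (b :+ d)) refl _ _ _ _)

  Σ-*ˡ : ∀ n x (f : Fin n → Carrier) → x * Σᶠ n f ≈ Σᶠ n (λ i → x * f i)
  Σ-*ˡ zero    x f = zeroʳ x
  Σ-*ˡ (suc n) x f = trans (distribˡ x _ _) (+-congˡ (Σ-*ˡ n x (f ∘ suc)))

  Σ-comm : ∀ m n (f : Fin m → Fin n → Carrier) →
    Σᶠ m (λ i → Σᶠ n (f i)) ≈ Σᶠ n (λ j → Σᶠ m (λ i → f i j))
  Σ-comm zero    n f = sym (Σ-zero n (λ _ → refl))
  Σ-comm (suc m) n f = trans (+-congˡ (Σ-comm m n (f ∘ suc))) (sym (Σ-+ n _ _))

  Π-cong : ∀ n {f g : Fin n → Carrier} → (∀ i → f i ≈ g i) → Πᶠ n f ≈ Πᶠ n g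
  Π-cong zero    e = refl
  Π-cong (suc n) e = *-cong (e zero) (Π-cong n (e ∘ suc))

  Π-one : ∀ n {f : Fin n → Carrier} → (∀ i → f i ≈ 1#) → Πᶠ n f ≈ 1#
  Π-one zero    e = refl
  Π-one (suc n) e = trans (*-cong (e zero) (Π-one n (e ∘ suc))) (*-identityˡ 1#)

  Π-* : ∀ n (f g : Fin n → Carrier) → Πᶠ n (λ i → f i * g i) ≈ Πᶠ n f * Πᶠ n g
  Π-* zero    f g = sym (*-identityˡ 1#)
  Π-* (suc n) f g = trans (*-congˡ (Π-* n (f ∘ suc) (g ∘ suc)))
    (solve 4 (λ a b c d → (a :* b) :* (c :* d) := (a :* c) :* (b :* d)) refl _ _ _ _)

  Π-punchIn : ∀ n (k : Fin (suc n)) (f : Fin (suc n) → Carrier) →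
    Πᶠ (suc n) f ≈ f k * Πᶠ n (f ∘ punchIn k)
  Π-punchIn n       zero    f = refl
  Π-punchIn (suc n) (suc k) f = trans (*-congˡ (Π-punchIn n k (f ∘ suc)))
    (solve 3 (λ a b c → a :* (b :* c) := b :* (a :* c)) refl _ _ _)

  Π<-suc : ∀ n (f : Fin (suc n) → Fin (suc n) → Carrier) →
    Π< (suc n) f ≈ Πᶠ n (λ j → f zero (suc j)) * Π< n (λ i j → f (suc i) (suc j))
  Π<-suc n f = *-cong (*-identityˡ _) (Π-cong n (λ i → trans (*-identityˡ _) (Π-cong n (λ j →
    reflexive (≡.cong (λ b → if b then f (suc i) (suc j) else 1#) (suc-<? i j))))))

  Π≤-suc : ∀ n (f : Fin (suc n) → Fin (suc n) → Carrier) →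
    Π≤ (suc n) f ≈ Πᶠ (suc n) (f zero) * Π≤ n (λ i j → f (suc i) (suc j))
  Π≤-suc n f = *-congˡ (Π-cong n (λ i → trans (*-identityˡ _) (Π-cong n (λ j →
    reflexive (≡.cong (λ b → if b then 1# else f (suc i) (suc j)) (suc-<? j i))))))

  Π<-cong : ∀ n {f g : Fin n → Fin n → Carrier} → (∀ i j → f i j ≈ g i j) → Π< n f ≈ Π< n g
  Π<-cong n e = Π-cong n (λ i → Π-cong n (λ j → if-cong ⌊ i <? j ⌋ (e i j)))
    where
    if-cong : ∀ b {x y : Carrier} → x ≈ y → (if b then x else 1#) ≈ (if b then y else 1#)
    if-cong true  e = e
    if-cong false e = refl

  module _ {A : Set} where

    Σˡ-cong : ∀ {p} {P : A → Set p} {xs} {f g : A → Carrier} → All P xs →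
      (∀ x → P x → f x ≈ g x) → Σˡ xs f ≈ Σˡ xs g
    Σˡ-cong []         e = refl
    Σˡ-cong (px ∷ pxs) e = +-cong (e _ px) (Σˡ-cong pxs e)

    Σˡ-*ˡ : ∀ xs a (f : A → Carrier) → Σˡ xs (λ x → a * f x) ≈ a * Σˡ xs f
    Σˡ-*ˡ []       a f = sym (zeroʳ a)
    Σˡ-*ˡ (x ∷ xs) a f = trans (+-congˡ (Σˡ-*ˡ xs a f)) (sym (distribˡ a _ _))

    Σˡ-++ : ∀ xs ys (f : A → Carrier) → Σˡ (xs ++ ys) f ≈ Σˡ xs f + Σˡ ys f
    Σˡ-++ []       ys f = sym (+-identityˡ _)
    Σˡ-++ (x ∷ xs) ys f = trans (+-congˡ (Σˡ-++ xs ys f)) (sym (+-assoc _ _ _))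

    Σˡ-map : ∀ {B : Set} (g : B → A) xs (f : A → Carrier) → Σˡ (map g xs) f ≡ Σˡ xs (f ∘ g)
    Σˡ-map g []       f = ≡.refl
    Σˡ-map g (x ∷ xs) f = ≡.cong (f (g x) +_) (Σˡ-map g xs f)

    Σˡ-concatMap : ∀ {B : Set} (g : B → List A) xs (f : A → Carrier) →
      Σˡ (concatMap g xs) f ≈ Σˡ xs (λ x → Σˡ (g x) f)
    Σˡ-concatMap g []       f = refl
    Σˡ-concatMap g (x ∷ xs) f =
      trans (Σˡ-++ (g x) (concatMap g xs) f) (+-congˡ (Σˡ-concatMap g xs f))

    Σˡ-Σ-comm : ∀ xs n (f : A → Fin n → Carrier) →
      Σˡ xs (λ x → Σᶠ n (f x)) ≈ Σᶠ n (λ k → Σˡ xs (λ x → f x k))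
    Σˡ-Σ-comm []       n f = sym (Σ-zero n (λ _ → refl))
    Σˡ-Σ-comm (x ∷ xs) n f = trans (+-congˡ (Σˡ-Σ-comm xs n f)) (sym (Σ-+ n _ _))

  Σˡ-fins : ∀ n (f : Fin n → Carrier) → Σˡ (fins n) f ≈ Σᶠ n f
  Σˡ-fins zero    f = refl
  Σˡ-fins (suc n) f = +-congˡ (trans (reflexive (Σˡ-map suc (fins n) f)) (Σˡ-fins n (f ∘ suc)))

  -- Expansion of antisymmetrizers along σ(0)

  -- Entries of `allPerms` are bare functions. Invariance of finite products is the one consequence
  -- of bijectivity that the proof uses, and it passes directly through `extend`.
  Reindexing : ∀ {n} → (Fin n → Fin n) → Set (c ⊔ ℓ)
  Reindexing {n} π = ∀ f → Πᶠ n (f ∘ π) ≈ Πᶠ n f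

  extend-reindexing : ∀ {n} k (π : Fin n → Fin n) → Reindexing π → Reindexing (extend n k π)
  extend-reindexing {n} k π r f = trans (*-congˡ (r (f ∘ punchIn k))) (sym (Π-punchIn n k f))

  allPerms-reindexing : ∀ n → All Reindexing (allPerms n)
  allPerms-reindexing zero    = (λ f → refl) ∷ []
  allPerms-reindexing (suc n) = All.concat⁺ (All.map⁺ (All.map
    (λ {π} r → All.map⁺ (All.universal (λ k → extend-reindexing k π r) (fins (suc n))))
    (allPerms-reindexing n)))

  sign : ∀ {n} → Fin n → Carrier
  sign zero    = 1#
  sign (suc k) = - 1# * sign k

  -- (k, punchIn k j) is an inversion exactly for the first k values of j.
  Π-below : ∀ n (k : Fin (suc n)) →
    Πᶠ n (λ j → if ⌊ punchIn k j <? k ⌋ then - 1# else 1#) ≈ sign k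
  Π-below n       zero    = Π-one n (λ j → refl)
  Π-below (suc n) (suc k) = *-congˡ (trans
    (Π-cong n (λ j →
      reflexive (≡.cong (λ b → if b then - 1# else 1#) (suc-<? (punchIn k j) k))))
    (Π-below n k))

  -- Inversions involving position `zero` contribute a product over the values of `π`, which
  -- reindexing and `Π-below` turn into `sign k`. The others are those of `π`, since `punchIn k`
  -- preserves order.
  sgn-extend : ∀ n k (π : Fin n → Fin n) → Reindexing π → sgn (extend n k π) ≈ sign k * sgn π
  sgn-extend n k π r = trans
    (Π<-suc n (λ i j → if ⌊ extend n k π j <? extend n k π i ⌋ then - 1# else 1#)) (*-cong
    (trans (r (λ a → if ⌊ punchIn k a <? k ⌋ then - 1# else 1#)) (Π-below n k))
    (Π<-cong n (λ i j →
      reflexive (≡.cong (λ b → if b then - 1# else 1#) (punchIn-<? k (π j) (π i))))))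

  ASᵢ-cong : ∀ n {F G : (Fin n → Fin n) → Carrier} →
    (∀ π → Reindexing π → F π ≈ G π) → ASᵢ n F ≈ ASᵢ n G
  ASᵢ-cong n e = Σˡ-cong (allPerms-reindexing n) (λ π r → *-congˡ (e π r))

  ASᵢ-*ˡ : ∀ n a (F : (Fin n → Fin n) → Carrier) → ASᵢ n (λ π → a * F π) ≈ a * ASᵢ n F
  ASᵢ-*ˡ n a F = trans
    (Σˡ-cong (allPerms-reindexing n) (λ π r →
      solve 3 (λ s a f → s :* (a :* f) := a :* (s :* f)) refl _ _ _))
    (Σˡ-*ˡ (allPerms n) a _)

  -- `allPerms` groups permutations by `π`; exchanging the two sums groups them by the value `k` at
  -- `zero` instead.
  ASᵢ-suc : ∀ n (F : (Fin (suc n) → Fin (suc n)) → Carrier) →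
    ASᵢ (suc n) F ≈ Σᶠ (suc n) (λ k → sign k * ASᵢ n (λ π → F (extend n k π)))
  ASᵢ-suc n F = begin
    ASᵢ (suc n) F
      ≈⟨ Σˡ-concatMap _ (allPerms n) _ ⟩
    Σˡ (allPerms n) (λ π → Σˡ (map (λ k → extend n k π) (fins (suc n))) term)
      ≈⟨ Σˡ-cong (allPerms-reindexing n) (λ π r → trans
           (reflexive (Σˡ-map (λ k → extend n k π) (fins (suc n)) term))
           (Σˡ-fins (suc n) (λ k → term (extend n k π)))) ⟩
    Σˡ (allPerms n) (λ π → Σᶠ (suc n) (λ k → term (extend n k π)))
      ≈⟨ Σˡ-Σ-comm (allPerms n) (suc n) (λ π k → term (extend n k π)) ⟩
    Σᶠ (suc n) (λ k → Σˡ (allPerms n) (λ π → term (extend n k π)))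
      ≈⟨ Σ-cong (suc n) (λ k → trans
           (Σˡ-cong (allPerms-reindexing n) (λ π r →
             trans (*-congʳ {F (extend n k π)} (sgn-extend n k π r))
               (*-assoc (sign k) (sgn π) (F (extend n k π)))))
           (Σˡ-*ˡ (allPerms n) (sign k) (λ π → sgn π * F (extend n k π)))) ⟩
    Σᶠ (suc n) (λ k → sign k * ASᵢ n (λ π → F (extend n k π))) ∎
    where
    term : (Fin (suc n) → Fin (suc n)) → Carrier
    term σ = sgn σ * F σ

  -- Laplace expansions

  -- The expansion runs along the first column because the antisymmetrizer recursion deletes an
  -- arbitrary `w k` together with `y zero`. Unfolding `det` gives the first row instead;
  -- `laplace-row` reconciles the two.
  laplace : ∀ n → (Fin n → Fin n → Carrier) → Carrier
  laplace zero    M = 1#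
  laplace (suc n) M = Σᶠ (suc n) (λ k →
    sign k * (M k zero * laplace n (λ i j → M (punchIn k i) (suc j))))

  laplace-cong : ∀ n {M N : Fin n → Fin n → Carrier} →
    (∀ i j → M i j ≈ N i j) → laplace n M ≈ laplace n N
  laplace-cong zero    e = refl
  laplace-cong (suc n) e = Σ-cong (suc n) (λ k → *-congˡ {sign k}
    (*-cong (e k zero) (laplace-cong n (λ i j → e (punchIn k i) (suc j)))))

  -- The corner terms agree. In every other term the minor still contains row `zero` on the left and
  -- column `zero` on the right; expanding along it turns both sides into the same double sum, in
  -- opposite orders of summation.
  laplace-row : ∀ n (M : Fin (suc n) → Fin (suc n) → Carrier) →
    laplace (suc n) M ≈ Σᶠ (suc n) (λ k →
      sign k * (M zero k * laplace n (λ i j → M (suc i) (punchIn k j))))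
  laplace-row zero    M = refl
  laplace-row (suc n) M = +-congˡ (begin
    Σᶠ m (λ k → (- 1# * sign k) *
        (M (suc k) zero * laplace m (λ i j → M (punchIn (suc k) i) (suc j))))
      ≈⟨ Σ-cong m (λ k → trans
           (*-congˡ (*-congˡ (laplace-row n (λ i j → M (punchIn (suc k) i) (suc j)))))
           (pull (sign k) (M (suc k) zero) (λ l → sign l) (λ l → M zero (suc l)) (minor k))) ⟩
    Σᶠ m (λ k → Σᶠ m (λ l → double k l))
      ≈⟨ Σ-comm m m double ⟩
    Σᶠ m (λ l → Σᶠ m (λ k → double k l))
      ≈⟨ Σ-cong m (λ l → trans
           (Σ-cong m (λ k → swap (sign k) (M (suc k) zero) (sign l) (M zero (suc l)) (minor k l)))
           (sym (pull (sign l) (M zero (suc l)) (λ k → sign k) (λ k → M (suc k) zero)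
             (λ k → minor k l)))) ⟩
    Σᶠ m (λ l → (- 1# * sign l) *
        (M zero (suc l) * laplace m (λ i j → M (suc i) (punchIn (suc l) j)))) ∎)
    where
    m : ℕ
    m = suc n
    minor : Fin m → Fin m → Carrier
    minor k l = laplace n (λ i j → M (suc (punchIn k i)) (suc (punchIn l j)))
    double : Fin m → Fin m → Carrier
    double k l = ((- 1# * sign k) * M (suc k) zero) * (sign l * (M zero (suc l) * minor k l))
    pull : ∀ s a (t b d : Fin m → Carrier) →
      (- 1# * s) * (a * Σᶠ m (λ l → t l * (b l * d l)))
      ≈ Σᶠ m (λ l → ((- 1# * s) * a) * (t l * (b l * d l)))
    pull s a t b d =
      trans (sym (*-assoc _ _ _)) (Σ-*ˡ m _ (λ l → t l * (b l * d l)))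
    swap : ∀ s a t b d → ((- 1# * s) * a) * (t * (b * d)) ≈ ((- 1# * t) * b) * (s * (a * d))
    swap s a t b d = solve 6 (λ o s a t b d →
      ((o :* s) :* a) :* (t :* (b :* d)) := ((o :* t) :* b) :* (s :* (a :* d))) refl (- 1#) s a t b d

  det≈laplace : ∀ n (M : Fin n → Fin n → Carrier) → det n M ≈ laplace n M
  det≈laplace zero    M = trans (+-identityʳ _) (*-identityˡ 1#)
  det≈laplace (suc n) M = begin
    det (suc n) M
      ≈⟨ ASᵢ-suc n _ ⟩
    Σᶠ (suc n) (λ k → sign k *
        ASᵢ n (λ π → M zero k * Πᶠ n (λ i → M (suc i) (punchIn k (π i)))))
      ≈⟨ Σ-cong (suc n) (λ k → *-congˡ {sign k} (trans
           (ASᵢ-*ˡ n (M zero k) (λ π → Πᶠ n (λ i → M (suc i) (punchIn k (π i)))))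
           (*-congˡ (det≈laplace n (λ i j → M (suc i) (punchIn k j)))))) ⟩
    Σᶠ (suc n) (λ k → sign k * (M zero k * laplace n (λ i j → M (suc i) (punchIn k j))))
      ≈⟨ laplace-row n M ⟨
    laplace (suc n) M ∎

  -- Vanishing of determinants with a repeated column.

  -1*-1*x≈x : ∀ x → (- 1# * - 1#) * x ≈ x
  -1*-1*x≈x x = trans (*-congʳ (trans (-1*x≈-x _) (-‿involutive 1#))) (*-identityˡ x)

  -- Laplace expansion along two leading columns `v` and `u`; `G` sends the embedding of the
  -- remaining rows to the complementary minor.
  twofold : ∀ n (v u : Fin (suc (suc n)) → Carrier) →
    ((Fin n → Fin (suc (suc n))) → Carrier) → Carrier
  twofold n v u G = Σᶠ (suc (suc n)) (λ k → sign k * (v k *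
    Σᶠ (suc n) (λ l → sign l * (u (punchIn k l) * G (punchIn k ∘ punchIn l)))))

  -- The terms of the double expansion in which the row used by v precedes the one used by u.
  ordered : ∀ n (v u : Fin (suc (suc n)) → Carrier) →
    ((Fin n → Fin (suc (suc n))) → Carrier) → Carrier
  ordered zero    v u G =
    v zero * Σᶠ 1 (λ l → sign l * (u (suc l) * G (suc ∘ punchIn l)))
  ordered (suc n) v u G =
    v zero * Σᶠ (suc (suc n)) (λ l → sign l * (u (suc l) * G (suc ∘ punchIn l)))
    + ordered n (v ∘ suc) (u ∘ suc) (G ∘ lift)

  -- Which of `v` and `u` takes the earlier row only affects the sign. The induction asks whether
  -- row `zero` is taken by `v`, by `u` or by neither.
  twofold-split : ∀ n v u (G : (Fin n → Fin (suc (suc n))) → Carrier) →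
    (∀ {ρ τ} → ρ ≗ τ → G ρ ≈ G τ) →
    twofold n v u G ≈ ordered n v u G + - 1# * ordered n u v G
  twofold-split n v u G G-cong = trans
    (+-cong (*-identityˡ _) (trans (Σ-cong (suc n) first-row)
      (trans (Σ-+ (suc n) (λ k → (- 1# * u zero) * u-first k) (lower n v u G))
        (+-congʳ (sym (trans (sym (*-assoc _ _ _)) (Σ-*ˡ (suc n) (- 1# * u zero) u-first)))))))
    (rest n v u G G-cong)
    where
    -- In `u-first` row `zero` is taken by `u`; in `lower` it is taken by neither column.
    u-first : Fin (suc n) → Carrier
    u-first k = sign k * (v (suc k) * G (suc ∘ punchIn k))
    lower : ∀ n (v u : Fin (suc (suc n)) → Carrier) →
      ((Fin n → Fin (suc (suc n))) → Carrier) → Fin (suc n) → Carrier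
    lower n v u G k = (- 1# * sign k) * (v (suc k) * Σᶠ n (λ l → (- 1# * sign l) *
      (u (suc (punchIn k l)) * G (punchIn (suc k) ∘ punchIn (suc l)))))
    first-row : ∀ k →
      (- 1# * sign k) * (v (suc k) * (1# * (u zero * G (suc ∘ punchIn k)) +
        Σᶠ n (λ l → (- 1# * sign l) *
          (u (suc (punchIn k l)) * G (punchIn (suc k) ∘ punchIn (suc l))))))
      ≈ (- 1# * u zero) * u-first k + lower n v u G k
    first-row k = trans (*-congˡ (*-congˡ (+-congʳ (*-identityˡ _))))
      (solve 6 (λ o s v u g t → (o :* s) :* (v :* (u :* g :+ t))
        := (o :* u) :* (s :* (v :* g)) :+ (o :* s) :* (v :* t)) refl _ _ _ _ _ _)
    rest : ∀ n v u (G : (Fin n → Fin (suc (suc n))) → Carrier) →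
      (∀ {ρ τ} → ρ ≗ τ → G ρ ≈ G τ) →
      v zero * Σᶠ (suc n) (λ l → sign l * (u (suc l) * G (suc ∘ punchIn l)))
      + (- 1# * (u zero * Σᶠ (suc n) (λ l → sign l * (v (suc l) * G (suc ∘ punchIn l))))
        + Σᶠ (suc n) (lower n v u G))
      ≈ ordered n v u G + - 1# * ordered n u v G
    -- With only two rows, no two distinct rows both avoid row `zero`, so `lower` contributes zero.
    rest zero v u G G-cong = +-congˡ (trans
      (+-congˡ (trans (+-identityʳ _) (trans (*-congˡ (zeroʳ _)) (zeroʳ _)))) (+-identityʳ _))
    rest (suc n) v u G G-cong = trans
      (+-congˡ (+-congˡ (trans (Σ-cong (suc (suc n)) shift)
        (twofold-split n (v ∘ suc) (u ∘ suc) (G ∘ lift) (λ e → G-cong (lift-cong e))))))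
      (solve 5 (λ o a b c d → a :+ (o :* b :+ (c :+ o :* d))
        := (a :+ c) :+ o :* (b :+ d)) refl _ _ _ _ _)
      where
      shift : ∀ k → lower (suc n) v u G k ≈ sign k * (v (suc k) *
        Σᶠ (suc n) (λ l → sign l *
          (u (suc (punchIn k l)) * G (lift (punchIn k ∘ punchIn l)))))
      -- Dropping row `zero` shifts both row positions by one, and the two resulting factors `- 1#`
      -- cancel.
      shift k = begin
        lower (suc n) v u G k
          ≈⟨ *-congˡ (*-congˡ (trans
               (Σ-cong (suc n) (λ l → trans (*-assoc (- 1#) (sign l) _)
                 (*-congˡ (*-congˡ {sign l} (*-congˡ {u (suc (punchIn k l))}
                   (G-cong (punchIn-lift k l)))))))
               (sym (Σ-*ˡ (suc n) (- 1#) s)))) ⟩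
        (- 1# * sign k) * (v (suc k) * (- 1# * Σᶠ (suc n) s))
          ≈⟨ solve 4 (λ o s v t → (o :* s) :* (v :* (o :* t)) := (o :* o) :* (s :* (v :* t)))
               refl _ _ _ _ ⟩
        (- 1# * - 1#) * (sign k * (v (suc k) * Σᶠ (suc n) s))
          ≈⟨ -1*-1*x≈x _ ⟩
        sign k * (v (suc k) * Σᶠ (suc n) s) ∎
        where
        s : Fin (suc n) → Carrier
        s l = sign l * (u (suc (punchIn k l)) * G (lift (punchIn k ∘ punchIn l)))

  -- The sum is the determinant of `M` with column `i` prepended. For column `zero` the two
  -- orderings cancel termwise, so no division by two occurs; other columns reduce to smaller
  -- minors.
  laplace-repeated : ∀ n (M : Fin (suc n) → Fin n → Carrier) (i : Fin n) →
    Σᶠ (suc n) (λ k → sign k * (M k i * laplace n (λ a b → M (punchIn k a) b))) ≈ 0#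
  laplace-repeated (suc n) M i = trans (expand i) (vanish i)
    where
    col : Fin (suc n) → Fin (suc (suc n)) → Carrier
    col j a = M a j
    G : (Fin n → Fin (suc (suc n))) → Carrier
    G ρ = laplace n (λ a b → M (ρ a) (suc b))
    G-cong : ∀ {ρ τ} → ρ ≗ τ → G ρ ≈ G τ
    G-cong e = laplace-cong n (λ a b → reflexive (≡.cong (λ r → M r (suc b)) (e a)))
    expand : ∀ i →
      Σᶠ (suc (suc n)) (λ k → sign k * (M k i * laplace (suc n) (λ a b → M (punchIn k a) b)))
      ≈ ordered n (col i) (col zero) G + - 1# * ordered n (col zero) (col i) G
    expand i = twofold-split n (col i) (col zero) G G-cong
    vanish : ∀ i →
      ordered n (col i) (col zero) G + - 1# * ordered n (col zero) (col i) G ≈ 0#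
    vanish zero    = trans (+-congˡ (-1*x≈-x _)) (-‿inverseʳ _)
    -- Exchanging the two leading columns costs a sign. Each inner sum is then the lemma itself for
    -- the minor without row `k` and column `zero`.
    vanish (suc i) = begin
      ordered n (col (suc i)) (col zero) G + - 1# * ordered n (col zero) (col (suc i)) G
        ≈⟨ trans (+-congʳ (sym (-1*-1*x≈x _)))
           (solve 3 (λ o a b → (o :* o) :* a :+ o :* b := o :* (b :+ o :* a)) refl _ _ _) ⟩
      - 1# * (ordered n (col zero) (col (suc i)) G
              + - 1# * ordered n (col (suc i)) (col zero) G)
        ≈⟨ *-congˡ (twofold-split n (col zero) (col (suc i)) G G-cong) ⟨
      - 1# * twofold n (col zero) (col (suc i)) G
        ≈⟨ *-congˡ (Σ-zero (suc (suc n)) (λ k → trans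
             (*-congˡ {sign k} (trans
               (*-congˡ {col zero k} (laplace-repeated n (λ a b → M (punchIn k a) (suc b)) i))
               (zeroʳ (col zero k))))
             (zeroʳ (sign k)))) ⟩
      - 1# * 0#
        ≈⟨ zeroʳ _ ⟩
      0# ∎

  -- Lagrange interpolation

  telescope : ∀ a b c → (a - b) + (b - c) ≈ a - c
  telescope a b c = trans (+-assoc a (- b) (b - c)) (+-congˡ
    (trans (sym (+-assoc (- b) b (- c))) (trans (+-congʳ (-‿inverseˡ b)) (+-identityˡ _))))

  -- Partial fractions of ∏ (α - γ u_j) / ∏ (α - γ y_i). The induction step eliminates u₀ through
  -- (u₀ - y_i) (y₁ - y₀) = (u₀ - y₀) (y₁ - y_i) - (u₀ - y₁) (y₀ - y_i),
  -- each term of which cancels one of the nodes y₁, y₀.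
  lagrange : ∀ n (α γ : Carrier) (u : Fin n → Carrier) (y Q : Fin (suc n) → Carrier)
    (D : Fin (suc n) → Fin (suc n) → Carrier) →
    (∀ i j → i ≢ j → (y j - y i) * D i j ≈ 1#) →
    (∀ i → (α - γ * y i) * Q i ≈ 1#) →
    Σᶠ (suc n) (λ i → (Πᶠ n (λ j → u j - y i) * Πᶠ n (λ m → D i (punchIn i m))) * Q i)
    ≈ Πᶠ n (λ j → α - γ * u j) * Πᶠ (suc n) Q
  lagrange zero α γ u y Q D D-inv Q-inv = trans (+-identityʳ _)
    (trans (*-assoc _ _ _) (*-congˡ (trans (*-identityˡ _) (sym (*-identityʳ _)))))
  -- `D₀₁` inverts `r`, so it suffices to compare both sides after multiplication by `r`.
  lagrange (suc n) α γ u y Q D D-inv Q-inv = begin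
    S
      ≈⟨ trans (*-congʳ (D-inv zero one (λ ()))) (*-identityˡ S) ⟨
    (r * D₀₁) * S
      ≈⟨ solve 3 (λ r d s → (r :* d) :* s := d :* (r :* s)) refl r D₀₁ S ⟩
    D₀₁ * (r * S)
      ≈⟨ *-congˡ rS ⟩
    D₀₁ * (r * (Πᶠ (suc n) (λ j → α - γ * u j) * Πᶠ (suc (suc n)) Q))
      ≈⟨ solve 3 (λ r d s → (r :* d) :* s := d :* (r :* s)) refl r D₀₁ _ ⟨
    (r * D₀₁) * (Πᶠ (suc n) (λ j → α - γ * u j) * Πᶠ (suc (suc n)) Q)
      ≈⟨ trans (*-congʳ (D-inv zero one (λ ()))) (*-identityˡ _) ⟩
    Πᶠ (suc n) (λ j → α - γ * u j) * Πᶠ (suc (suc n)) Q ∎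
    where
    one : Fin (suc (suc n))
    one = suc zero
    p r g D₀₁ : Carrier
    p = u zero - y one
    r = y one - y zero
    g = α - γ * u zero
    D₀₁ = D zero one
    U : Fin (suc (suc n)) → Carrier
    U i = Πᶠ n (λ j → u (suc j) - y i)
    V : Fin (suc (suc n)) → Carrier
    V i = Πᶠ (suc n) (λ m → D i (punchIn i m))
    term : Fin (suc (suc n)) → Carrier
    term i = (((u zero - y i) * U i) * V i) * Q i
    S : Carrier
    S = Σᶠ (suc (suc n)) term

    omit : Fin (suc (suc n)) → Fin (suc n) → Carrier
    -- The summand of the smaller interpolation problem without the node `y a` and the variable
    -- `u zero`.
    omit a i = (U (punchIn a i) * Πᶠ n (λ m → D (punchIn a i) (punchIn a (punchIn i m))))
      * Q (punchIn a i)

    omit-lagrange : ∀ a → Σᶠ (suc n) (omit a) ≈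
      Πᶠ n (λ j → α - γ * u (suc j)) * Πᶠ (suc n) (Q ∘ punchIn a)
    omit-lagrange a = lagrange n α γ (u ∘ suc) (y ∘ punchIn a) (Q ∘ punchIn a)
      (λ i j → D (punchIn a i) (punchIn a j))
      (λ i j i≢j → D-inv (punchIn a i) (punchIn a j) (i≢j ∘ punchIn-injective a i j))
      (λ i → Q-inv (punchIn a i))

    full : Fin (suc (suc n)) → Fin (suc (suc n)) → Carrier
    -- The factor `y a - y i` cancels `D i a` inside `V i` and vanishes at `i = a`, so `omit a` is
    -- summed over all nodes.
    full a i = (y a - y i) * ((U i * V i) * Q i)

    full-sum : ∀ a → (∀ i → full a (punchIn a i) ≈ omit a i) →
      Σᶠ (suc (suc n)) (full a) ≈ Σᶠ (suc n) (omit a)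
    full-sum a e = trans (Σ-punchIn a (full a)) (trans
      (+-cong (trans (*-congʳ (-‿inverseʳ (y a))) (zeroˡ _)) (Σ-cong (suc n) e))
      (+-identityˡ _))
      where
      Σ-punchIn : ∀ {n} (k : Fin (suc n)) (f : Fin (suc n) → Carrier) →
        Σᶠ (suc n) f ≈ f k + Σᶠ n (f ∘ punchIn k)
      Σ-punchIn         zero    f = refl
      Σ-punchIn {suc n} (suc k) f = trans (+-congˡ (Σ-punchIn k (f ∘ suc)))
        (solve 3 (λ a b c → a :+ (b :+ c) := b :+ (a :+ c)) refl _ _ _)

    cancel : ∀ d x a b e → d * x ≈ 1# → d * ((a * (x * b)) * e) ≈ (a * b) * e
    cancel d x a b e dx = trans
      (solve 5 (λ d x a b e → d :* ((a :* (x :* b)) :* e) := (d :* x) :* ((a :* b) :* e))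
        refl d x a b e)
      (trans (*-congʳ dx) (*-identityˡ _))

    full-omit₀ : ∀ i → full zero (suc i) ≈ omit zero i
    full-omit₀ i = cancel _ _ _ _ _ (D-inv (suc i) zero (λ ()))

    full-omit₁ : ∀ i → full one (punchIn one i) ≈ omit one i
    full-omit₁ zero    = cancel _ _ _ _ _ (D-inv zero one (λ ()))
    -- The factor of node `zero` comes first in `V`; the factor of node `one` has to be moved in
    -- front of it to cancel.
    full-omit₁ (suc i) = trans
      (*-congˡ (*-congʳ (*-congˡ (Π-one-first i (D (suc (suc i)))))))
      (cancel _ _ _ _ _ (D-inv (suc (suc i)) one (λ ())))
      where
      Π-one-first : ∀ {n} (i : Fin n) (f : Fin (suc (suc n)) → Carrier) →
        Πᶠ (suc n) (λ m → f (punchIn (suc (suc i)) m)) ≈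
        f (suc zero) * Πᶠ n (λ m → f (punchIn (suc zero) (punchIn (suc i) m)))
      Π-one-first {suc n} i f =
        solve 3 (λ a b c → a :* (b :* c) := b :* (a :* c)) refl _ _ _

    W Z : Carrier
    W = Πᶠ n (λ j → α - γ * u (suc j))
    Z = Πᶠ n (λ i → Q (suc (suc i)))

    pointwise : ∀ i → r * term i + p * full zero i ≈ (p + r) * full one i
    -- Here `u zero - y i` is `p + r + s` and `y one - y i` is `r + s`. The elimination identity
    -- becomes `r (p + r + s) + p s = (p + r) (r + s)`, free of subtraction and hence within reach
    -- of the semiring solver.
    pointwise i = begin
      r * ((((u zero - y i) * U i) * V i) * Q i) + p * (s * ((U i * V i) * Q i))
        ≈⟨ +-congʳ (*-congˡ (*-congʳ (*-congʳ (*-congʳ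
             (trans (+-congʳ (telescope _ _ _)) (telescope _ _ _)))))) ⟨
      r * (((((p + r) + s) * U i) * V i) * Q i) + p * (s * ((U i * V i) * Q i))
        ≈⟨ solve 6 (λ p r s a b e →
             r :* (((((p :+ r) :+ s) :* a) :* b) :* e) :+ p :* (s :* ((a :* b) :* e))
             := (p :+ r) :* ((r :+ s) :* ((a :* b) :* e))) refl p r s (U i) (V i) (Q i) ⟩
      (p + r) * ((r + s) * ((U i * V i) * Q i))
        ≈⟨ *-congˡ (*-congʳ (telescope _ _ _)) ⟩
      (p + r) * full one i ∎
      where
      s : Carrier
      s = y zero - y i

    summed : r * S + p * (W * (Q one * Z)) ≈ (p + r) * (W * (Q zero * Z))
    summed = begin
      r * S + p * (W * (Q one * Z))
        ≈⟨ +-congˡ (*-congˡ (trans (full-sum zero full-omit₀) (omit-lagrange zero))) ⟨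
      r * S + p * Σᶠ (suc (suc n)) (full zero)
        ≈⟨ +-cong (Σ-*ˡ (suc (suc n)) r term) (Σ-*ˡ (suc (suc n)) p (full zero)) ⟩
      Σᶠ (suc (suc n)) (λ i → r * term i) + Σᶠ (suc (suc n)) (λ i → p * full zero i)
        ≈⟨ Σ-+ (suc (suc n)) (λ i → r * term i) (λ i → p * full zero i) ⟨
      Σᶠ (suc (suc n)) (λ i → r * term i + p * full zero i)
        ≈⟨ Σ-cong (suc (suc n)) pointwise ⟩
      Σᶠ (suc (suc n)) (λ i → (p + r) * full one i)
        ≈⟨ Σ-*ˡ (suc (suc n)) (p + r) (full one) ⟨
      (p + r) * Σᶠ (suc (suc n)) (full one)
        ≈⟨ *-congˡ (trans (full-sum one full-omit₁) (omit-lagrange one)) ⟩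
      (p + r) * (W * (Q zero * Z)) ∎

    node : ∀ x → g + γ * (u zero - x) ≈ α - γ * x
    node x = trans (+-congˡ (x[y-z]≈xy-xz γ (u zero) x)) (telescope _ _ _)

    Q₀-inv : (g + γ * (p + r)) * Q zero ≈ 1#
    Q₀-inv = trans
      (*-congʳ (trans (+-congˡ (*-congˡ (telescope _ _ _))) (node (y zero)))) (Q-inv zero)

    Q₁-inv : (g + γ * p) * Q one ≈ 1#
    Q₁-inv = trans (*-congʳ (node (y one))) (Q-inv one)

    product : r * ((g * W) * (Q zero * (Q one * Z))) + p * (W * (Q one * Z))
      ≈ (p + r) * (W * (Q zero * Z))
    -- The expected closed form satisfies the same relation as `S` in `summed`; cancelling the
    -- common summand then yields `rS`. Both denominators are written through `g`, `γ`, `p` and `r`,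
    -- again to avoid subtraction.
    product = begin
      r * ((g * W) * (Q zero * (Q one * Z))) + p * (W * (Q one * Z))
        ≈⟨ +-congˡ (trans (*-congʳ Q₀-inv) (*-identityˡ _)) ⟨
      r * ((g * W) * (Q zero * (Q one * Z)))
      + ((g + γ * (p + r)) * Q zero) * (p * (W * (Q one * Z)))
        ≈⟨ solve 8 (λ r g W Q₀ Q₁ Z γ p →
             r :* ((g :* W) :* (Q₀ :* (Q₁ :* Z)))
               :+ ((g :+ γ :* (p :+ r)) :* Q₀) :* (p :* (W :* (Q₁ :* Z)))
             := ((g :+ γ :* p) :* Q₁) :* ((p :+ r) :* (W :* (Q₀ :* Z))))
             refl r g W (Q zero) (Q one) Z γ p ⟩
      ((g + γ * p) * Q one) * ((p + r) * (W * (Q zero * Z)))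
        ≈⟨ trans (*-congʳ Q₁-inv) (*-identityˡ _) ⟩
      (p + r) * (W * (Q zero * Z)) ∎

    rS : r * S ≈ r * (Πᶠ (suc n) (λ j → α - γ * u j) * Πᶠ (suc (suc n)) Q)
    rS = +-cancelʳ _ _ _ (trans summed (sym product))

  -- The antisymmetrized weight

  -- Arbitrary matrices replace the concrete factors so that deleting a row of `w` and the first `y`
  -- stays within the same form.
  weight : ∀ n (H P Q : Fin n → Fin n → Carrier) → (Fin n → Fin n) → Carrier
  weight n H P Q σ = Π< n (λ i j → H (σ i) (σ j))
    * Π≤ n (λ i j → P (σ j) i)
    * Π≤ n (λ j i → Q (σ j) i)

  -- The `P` factors at `y zero` run over all of `w` and come out of the sum. The `Q` factors at
  -- position `zero` involve row `k` alone, and the `H` factors there pair `k` with every other row.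
  ASᵢ-weight-suc : ∀ n (H P Q : Fin (suc n) → Fin (suc n) → Carrier) →
    ASᵢ (suc n) (weight (suc n) H P Q) ≈
    Πᶠ (suc n) (λ j → P j zero) * Σᶠ (suc n) (λ k → sign k *
      ((Πᶠ n (λ j → H k (punchIn k j)) * Πᶠ (suc n) (Q k)) *
       ASᵢ n (weight n (λ i j → H (punchIn k i) (punchIn k j))
         (λ i j → P (punchIn k i) (suc j)) (λ i j → Q (punchIn k i) (suc j)))))
  ASᵢ-weight-suc n H P Q = begin
    ASᵢ (suc n) (weight (suc n) H P Q)
      ≈⟨ ASᵢ-suc n (weight (suc n) H P Q) ⟩
    Σᶠ (suc n) (λ k → sign k * ASᵢ n (λ π → weight (suc n) H P Q (extend n k π)))
      ≈⟨ Σ-cong (suc n) (λ k → trans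
           (*-congˡ {sign k} (trans (ASᵢ-cong n (split k)) (ASᵢ-*ˡ n (p₀ * row k) (minor k))))
           (solve 4 (λ s p c a → s :* ((p :* c) :* a) := p :* (s :* (c :* a))) refl
             (sign k) p₀ (row k) (ASᵢ n (minor k)))) ⟩
    Σᶠ (suc n) (λ k → p₀ * (sign k * (row k * ASᵢ n (minor k))))
      ≈⟨ Σ-*ˡ (suc n) p₀ (λ k → sign k * (row k * ASᵢ n (minor k))) ⟨
    p₀ * Σᶠ (suc n) (λ k → sign k * (row k * ASᵢ n (minor k))) ∎
    where
    p₀ : Carrier
    p₀ = Πᶠ (suc n) (λ j → P j zero)
    row : Fin (suc n) → Carrier
    row k = Πᶠ n (λ j → H k (punchIn k j)) * Πᶠ (suc n) (Q k)
    minor : Fin (suc n) → (Fin n → Fin n) → Carrier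
    minor k = weight n (λ i j → H (punchIn k i) (punchIn k j))
      (λ i j → P (punchIn k i) (suc j)) (λ i j → Q (punchIn k i) (suc j))
    split : ∀ k π → Reindexing π →
      weight (suc n) H P Q (extend n k π) ≈ (p₀ * row k) * minor k π
    split k π r = trans
      (*-cong (*-cong
        (trans (Π<-suc n (λ i j → H (σ i) (σ j))) (*-congʳ (r (λ j → H k (punchIn k j)))))
        (trans (Π≤-suc n (λ i j → P (σ j) i))
          (*-congʳ (extend-reindexing k π r (λ j → P j zero)))))
        (Π≤-suc n (λ j i → Q (σ j) i)))
      (solve 6 (λ h x p y q z →
        ((h :* x) :* (p :* y)) :* (q :* z) := (p :* (h :* q)) :* ((x :* y) :* z))
        refl _ _ _ _ _ _)
      where
      σ : Fin (suc n) → Fin (suc n)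
      σ = extend n k π

  ASᵢ-weight : ∀ n (q q⁻¹ : Carrier) (w y : Fin n → Carrier) (P Q D : Fin n → Fin n → Carrier) →
    (∀ i j → (w i - y j) * P i j ≈ 1#) →
    (∀ i j → h q q⁻¹ (w i) (y j) * Q i j ≈ 1#) →
    (∀ i j → i ≢ j → (y j - y i) * D i j ≈ 1#) →
    ASᵢ n (weight n (λ i j → h q q⁻¹ (w i) (w j)) P Q)
    ≈ laplace n (λ i j → P i j * Q i j) * Π< n D
  ASᵢ-weight zero q q⁻¹ w y P Q D P-inv Q-inv D-inv = trans (+-identityʳ _)
    (trans (*-identityˡ _) (*-identityʳ _))
  ASᵢ-weight (suc n) q q⁻¹ w y P Q D P-inv Q-inv D-inv = begin
    ASᵢ (suc n) (weight (suc n) (λ i j → h q q⁻¹ (w i) (w j)) P Q)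
      ≈⟨ ASᵢ-weight-suc n (λ i j → h q q⁻¹ (w i) (w j)) P Q ⟩
    p₀ * Σᶠ (suc n) (λ k → sign k *
      ((Πᶠ n (λ j → h q q⁻¹ (w k) (w (punchIn k j))) * Πᶠ (suc n) (Q k)) *
       ASᵢ n (weight n (λ i j → h q q⁻¹ (w (punchIn k i)) (w (punchIn k j)))
         (λ i j → P (punchIn k i) (suc j)) (λ i j → Q (punchIn k i) (suc j)))))
      ≈⟨ *-congˡ (Σ-cong (suc n) (λ k → trans
           (*-congˡ {sign k} (*-cong (combination k) (hypothesis k))) (rearranged k))) ⟩
    p₀ * Σᶠ (suc n) (λ k → Σᶠ (suc n) (λ i → (β i * Y) * entry k i))
      ≈⟨ *-congˡ (trans (Σ-comm (suc n) (suc n) (λ k i → (β i * Y) * entry k i))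
           (Σ-cong (suc n) (λ i → sym (Σ-*ˡ (suc n) (β i * Y) (λ k → entry k i))))) ⟩
    p₀ * Σᶠ (suc n) (λ i → (β i * Y) * Σᶠ (suc n) (λ k → entry k i))
      -- For a later column the inner sum is a determinant with a repeated column, so only the index
      -- `zero` survives.
      ≈⟨ *-congˡ (trans (+-congˡ (Σ-zero n (λ i → trans
           (*-congˡ {β (suc i) * Y} (laplace-repeated n (λ a b → M a (suc b)) i))
           (zeroʳ (β (suc i) * Y))))) (+-identityʳ _)) ⟩
    p₀ * (((w₀ * D₀) * Y) * laplace (suc n) M)
      -- `w₀` and `D₀` are the two factors of `β zero`: the first is inverse to `p₀`, the second
      -- supplies the row of `Π< (suc n) D` at `zero`.
      ≈⟨ solve 5 (λ p a d y l → p :* (((a :* d) :* y) :* l) := (a :* p) :* (l :* (d :* y)))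
           refl p₀ w₀ D₀ Y (laplace (suc n) M) ⟩
    (w₀ * p₀) * (laplace (suc n) M * (D₀ * Y))
      ≈⟨ trans (*-congʳ (trans (sym (Π-* (suc n) (λ j → w j - y zero) (λ j → P j zero)))
           (Π-one (suc n) (λ j → P-inv j zero)))) (*-identityˡ _) ⟩
    laplace (suc n) M * (D₀ * Y)
      ≈⟨ *-congˡ (Π<-suc n D) ⟨
    laplace (suc n) M * Π< (suc n) D ∎
    where
    M : Fin (suc n) → Fin (suc n) → Carrier
    M i j = P i j * Q i j
    minor : Fin (suc n) → Carrier
    minor k = laplace n (λ i j → M (punchIn k i) (suc j))
    entry : Fin (suc n) → Fin (suc n) → Carrier
    entry k i = sign k * (M k i * minor k)
    p₀ w₀ D₀ Y : Carrier
    p₀ = Πᶠ (suc n) (λ j → P j zero)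
    w₀ = Πᶠ (suc n) (λ j → w j - y zero)
    D₀ = Πᶠ n (λ j → D zero (suc j))
    Y  = Π< n (λ i j → D (suc i) (suc j))
    β : Fin (suc n) → Carrier
    β i = Πᶠ (suc n) (λ j → w j - y i) * Πᶠ n (λ m → D i (punchIn i m))

    hypothesis : ∀ k →
      ASᵢ n (weight n (λ i j → h q q⁻¹ (w (punchIn k i)) (w (punchIn k j)))
        (λ i j → P (punchIn k i) (suc j)) (λ i j → Q (punchIn k i) (suc j)))
      ≈ minor k * Y
    hypothesis k = ASᵢ-weight n q q⁻¹ (w ∘ punchIn k) (y ∘ suc) _ _ _
      (λ i j → P-inv (punchIn k i) (suc j)) (λ i j → Q-inv (punchIn k i) (suc j))
      (λ i j i≢j → D-inv (suc i) (suc j) (i≢j ∘ suc-injective))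

    combination : ∀ k →
      Πᶠ n (λ j → h q q⁻¹ (w k) (w (punchIn k j))) * Πᶠ (suc n) (Q k)
      ≈ Σᶠ (suc n) (λ i → β i * M k i)
    combination k = trans
      -- With `α = q * w k` and `γ = q⁻¹`, each `α - γ * x` is `h q q⁻¹ (w k) x`.
      (sym (lagrange n (q * w k) q⁻¹ (w ∘ punchIn k) y (Q k) D D-inv (Q-inv k)))
      -- Inserting `(w k - y i) * P k i ≈ 1#` completes the product over the other rows to all rows,
      -- which makes `β i` independent of `k`.
      (Σ-cong (suc n) (λ i → sym (begin
        β i * M k i
          ≈⟨ *-congʳ (*-congʳ (Π-punchIn n k (λ j → w j - y i))) ⟩
        (((w k - y i) * X i) * E i) * (P k i * Q k i)
          ≈⟨ solve 5 (λ a x e p q → ((a :* x) :* e) :* (p :* q) := (a :* p) :* ((x :* e) :* q))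
               refl (w k - y i) (X i) (E i) (P k i) (Q k i) ⟩
        ((w k - y i) * P k i) * ((X i * E i) * Q k i)
          ≈⟨ trans (*-congʳ (P-inv k i)) (*-identityˡ _) ⟩
        (X i * E i) * Q k i ∎)))
      where
      X E : Fin (suc n) → Carrier
      X i = Πᶠ n (λ j → w (punchIn k j) - y i)
      E i = Πᶠ n (λ m → D i (punchIn i m))

    rearranged : ∀ k → sign k * (Σᶠ (suc n) (λ i → β i * M k i) * (minor k * Y))
      ≈ Σᶠ (suc n) (λ i → (β i * Y) * entry k i)
    rearranged k = trans
      (solve 4 (λ s t m y → s :* (t :* (m :* y)) := (s :* (m :* y)) :* t) refl
        (sign k) (Σᶠ (suc n) (λ i → β i * M k i)) (minor k) Y)
      (trans (Σ-*ˡ (suc n) (sign k * (minor k * Y)) (λ i → β i * M k i))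
        (Σ-cong (suc n) (λ i →
          solve 5 (λ s m y b a → (s :* (m :* y)) :* (b :* a) := (b :* y) :* (s :* (a :* m)))
            refl (sign k) (minor k) Y (β i) (M k i))))

  -- Specialization to the given inverses.

  theorem : Theorem5p3
  theorem n _ q q⁻¹ _ w y inv₁ inv₁-inv invq invq-inv invY invY-inv = begin
    ASᵢ n (weight n (λ i j → h q q⁻¹ (w i) (w j)) inv₁ invq)
      ≈⟨ ASᵢ-weight n q q⁻¹ w y inv₁ invq D
           (λ i j → trans (*-congʳ (sym (h₁ (w i) (y j)))) (inv₁-inv i j)) invq-inv D-inv ⟩
    laplace n M * Π< n D
      ≈⟨ *-cong (sym (det≈laplace n M)) Π<-D ⟩
    det n M * Π< n invY ∎
    where
    M : Fin n → Fin n → Carrier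
    M i j = inv₁ i j * invq i j

    h₁ : ∀ a b → h 1# 1# a b ≈ a - b
    h₁ a b = +-cong (*-identityˡ a) (-‿cong (*-identityˡ b))

    -- Interpolation needs inverses of `y j - y i` in both orders, so `invY` is extended
    -- antisymmetrically, with the default `1#` on the diagonal.
    D : Fin n → Fin n → Carrier
    D i j with <-cmp i j
    ... | tri< _ _ _ = invY i j
    ... | tri≈ _ _ _ = 1#
    ... | tri> _ _ _ = - invY j i

    D-inv : ∀ i j → i ≢ j → (y j - y i) * D i j ≈ 1#
    D-inv i j i≢j with <-cmp i j
    ... | tri< i<j _ _ = trans (*-congʳ (sym (h₁ (y j) (y i)))) (invY-inv i j i<j)
    ... | tri≈ _ i≡j _ = ⊥-elim (i≢j i≡j)
    ... | tri> _ _ j<i = begin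
      (y j - y i) * - invY j i  ≈⟨ -‿distribʳ-* _ _ ⟨
      - ((y j - y i) * invY j i)  ≈⟨ -‿distribˡ-* _ _ ⟩
      - (y j - y i) * invY j i  ≈⟨ *-congʳ (⁻¹-anti-homo‿- (y j) (y i)) ⟩
      (y i - y j) * invY j i  ≈⟨ *-congʳ (h₁ (y i) (y j)) ⟨
      h 1# 1# (y i) (y j) * invY j i  ≈⟨ invY-inv j i j<i ⟩
      1# ∎

    Π<-D : Π< n D ≈ Π< n invY
    Π<-D = Π-cong n (λ i → Π-cong n (λ j → above i j))
      where
      above : ∀ i j →
        (if ⌊ i <? j ⌋ then D i j else 1#) ≈ (if ⌊ i <? j ⌋ then invY i j else 1#)
      above i j with i <? j | <-cmp i j
      ... | yes _   | tri< _ _ _   = refl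
      ... | yes i<j | tri≈ i≮j _ _ = ⊥-elim (i≮j i<j)
      ... | yes i<j | tri> i≮j _ _ = ⊥-elim (i≮j i<j)
      ... | no _    | _            = refl

theorem5p3 : ∀ {c ℓ} (R : CommutativeRing c ℓ) → Ring.Theorem5p3 R
theorem5p3 R = theorem R
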